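{- Let $n\ge 1$. The number of parking functions of $1,\ldots,n$ for which the $n$-th spot is lucky is \[ \sum_{i=1}^nq_n(i,n)=\sum_{i=1}^nn^{n-2}=n^{n-1}. \]
   Context: There are $n$ spots labeled $1,\ldots,n$ in order along a one-way street, and $n$ cars entering one after another, car $i$ having preference $a_i\in\{1,\ldots,n\}$. Each car drives to its preferred spot and parks there if it is available; otherwise it moves forward and parks in the first available later spot, if any (if none, it fails to park). A parking function of $1,\ldots,n$ is a sequence of preferences $(a_1,\ldots,a_n)$ such that all $n$ cars are able to park. A car is lucky if it parks in its preferred spot; a spot is lucky if the car that parks in it prefers that spot. For $1\le i,j\le n$, $q_n(i,j)$ denotes the number of parking functions of $1,\ldots,n$ in which the $i$-th car prefers the $j$-th spot and the $i$-th car is lucky. Negative exponents are interpreted in the rational numbers. -}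

module Defs where

open import Data.Fin.Base using (Fin; zero; suc; fromℕ)
import Data.Fin.Properties as Fin
open import Data.Fin.Subset using (Subset; inside; outside; ⊥; ⁅_⁆; _∪_)
open import Data.Integer.Base as ℤ using (ℤ; +_; -[1+_])
open import Data.List.Base using (List; []; _∷_; [_]; allFin; cartesianProductWith; filter; length)
open import Data.List.Membership.Propositional using (_∈_)
open import Data.List.Membership.Propositional.Properties
  using (∈-allFin; ∈-cartesianProductWith⁺)
open import Data.List.Relation.Unary.Any using (here)
open import Data.List.Relation.Unary.AllPairs using ([]; _∷_)
import Data.List.Relation.Unary.All as List
open import Data.List.Relation.Unary.Unique.Propositional using (Unique)
open import Data.List.Relation.Unary.Unique.Propositional.Properties
  using (allFin⁺; cartesianProductWith⁺)
open import Data.Maybe.Base using (Maybe; just; nothing; map)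
open import Data.Maybe using (Is-just)
import Data.Maybe.Properties as Maybe
import Data.Maybe.Relation.Unary.Any as Maybe
open import Data.Nat.Base as ℕ using (ℕ; zero; suc; NonZero)
import Data.Nat.Properties as ℕ
open import Data.Product.Base using (_×_; _,_; ∃)
open import Data.Rational.Base as ℚ using (ℚ)
import Data.Rational.Properties as ℚ
open import Data.Unit.Base using (tt)
open import Data.Vec.Base using (Vec; []; _∷_; lookup)
import Data.Vec.Properties as Vec
open import Data.Vec.Relation.Unary.All as All using (All)
open import Level using (0ℓ)
open import Relation.Binary.PropositionalEquality using (_≡_; refl)
open import Relation.Nullary.Decidable using (yes; _×-dec_)
open import Relation.Unary using (Pred; Decidable)

open import Algebra.Properties.Monoid.Sum ℕ.+-0-monoid public
  using () renaming (sum to ∑ℕ)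
open import Algebra.Properties.Monoid.Sum ℚ.+-0-monoid public
  using () renaming (sum to ∑ℚ)

private
  variable
    m n : ℕ

-- Cars and spots are indexed from 0: car i ∈ {1,…,n} of the paper is the
-- element of Fin n with toℕ equal to i - 1, and likewise for spots.  A
-- `Subset n` of spots is the set of occupied ones (inside = occupied).

firstFree : Subset n → Maybe (Fin n)
firstFree []            = nothing
firstFree (outside ∷ s) = just zero
firstFree (inside  ∷ s) = map suc (firstFree s)

firstFreeFrom : Subset n → Fin n → Maybe (Fin n)
firstFreeFrom s       zero    = firstFree s
firstFreeFrom (_ ∷ s) (suc p) = map suc (firstFreeFrom s p)

occupy : Subset n → Maybe (Fin n) → Subset n
occupy s (just p) = ⁅ p ⁆ ∪ s
occupy s nothing  = s

-- The spot taken by each successive car (`nothing` if it fails to park),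
-- starting from a given set of occupied spots.
park : Subset n → Vec (Fin n) m → Vec (Maybe (Fin n)) m
park s []       = []
park s (p ∷ ps) = firstFreeFrom s p ∷ park (occupy s (firstFreeFrom s p)) ps

Preferences : ℕ → Set
Preferences n = Vec (Fin n) n

outcome : Preferences n → Vec (Maybe (Fin n)) n
outcome = park ⊥

IsParkingFunction : Pred (Preferences n) 0ℓ
IsParkingFunction a = All Is-just (outcome a)

ParksIn : Preferences n → Fin n → Fin n → Set
ParksIn a i j = lookup (outcome a) i ≡ just j

LuckyCar : Preferences n → Fin n → Set
LuckyCar a i = ParksIn a i (lookup a i)

LuckySpot : Preferences n → Fin n → Set
LuckySpot a j = ∃ λ i → ParksIn a i j × lookup a i ≡ j

isParkingFunction? : Decidable (IsParkingFunction {n})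
isParkingFunction? a = All.all? (Maybe.dec (λ _ → yes tt)) (outcome a)

parksIn? : (a : Preferences n) (i : Fin n) → Decidable (ParksIn a i)
parksIn? a i j = Maybe.≡-dec Fin._≟_ (lookup (outcome a) i) (just j)

luckyCar? : (a : Preferences n) → Decidable (LuckyCar a)
luckyCar? a i = parksIn? a i (lookup a i)

luckySpot? : (a : Preferences n) → Decidable (LuckySpot a)
luckySpot? a j = Fin.any? λ i → parksIn? a i j ×-dec (lookup a i Fin.≟ j)

allVecs : ∀ n m → List (Vec (Fin n) m)
allVecs n zero    = [ [] ]
allVecs n (suc m) = cartesianProductWith _∷_ (allFin n) (allVecs n m)

-- Every vector is listed exactly once, so that the length of a filtered
-- `allVecs` is a cardinality.
allVecs-complete : (v : Vec (Fin n) m) → v ∈ allVecs n m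
allVecs-complete []      = here refl
allVecs-complete (x ∷ v) =
  ∈-cartesianProductWith⁺ _∷_ (∈-allFin x) (allVecs-complete v)

allVecs-unique : ∀ n m → Unique (allVecs n m)
allVecs-unique n zero    = List.[] ∷ []
allVecs-unique n (suc m) =
  cartesianProductWith⁺ _∷_ Vec.∷-injective (allFin⁺ n) (allVecs-unique n m)

count : {P : Pred (Preferences n) 0ℓ} → Decidable P → ℕ
count {n} P? = length (filter P? (allVecs n n))

q : ∀ n → Fin n → Fin n → ℕ
q n i j = count {n} λ a →
  isParkingFunction? a ×-dec (lookup a i Fin.≟ j) ×-dec luckyCar? a i

#luckySpot : ∀ n → Fin n → ℕ
#luckySpot n j = count {n} λ a → isParkingFunction? a ×-dec luckySpot? a j

lastSpot : ∀ n .{{_ : NonZero n}} → Fin n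
lastSpot (suc m) = fromℕ m

fromℕℚ : ℕ → ℚ
fromℕℚ k = + k ℚ./ 1

infixr 8 _^ℤ_

_^ℤ_ : (b : ℕ) .{{_ : NonZero b}} → ℤ → ℚ
b ^ℤ (+ k)    = fromℕℚ (b ℕ.^ k)
b ^ℤ -[1+ k ] = ℚ._/_ (+ 1) (b ℕ.^ suc k) {{ℕ.m^n≢0 b (suc k)}}

{-# OPTIONS --safe #-}
-- Pollak's argument: let k cars park on a circle of n spots, each driving past
-- the end back to the first spot.  Every car occupies one vacant spot, so the
-- n^k preference lists leave n^k (n - k) vacant spots in total, and by rotation
-- every spot is left vacant equally often.  On the other hand, if car i prefers
-- the last spot n of the street, then all cars park exactly when the remaining
-- n - 1 cars, driving on the circle, leave spot n vacant; in particular that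
-- car is lucky.  Hence n · q n i n = n^(n-1) for every i.
module Submission where

open import Defs
open import Data.Fin.Base using (Fin)
open import Data.Integer.Base using (+_; _-_)
open import Data.Nat.Base using (ℕ; NonZero)
open import Data.Product.Base using (_×_)
open import Relation.Binary.PropositionalEquality using (_≡_)

open import Data.Bool.Base using (if_then_else_)
open import Data.Fin.Base using (zero; suc; fromℕ; inject₁; punchIn)
open import Data.Fin.Induction using (<-weakInduction)
import Data.Fin.Properties as Fin
open import Data.Fin.Relation.Unary.Top using (view; ‵fromℕ; ‵inject₁)
open import Data.Fin.Subset using (Subset; Side; inside; outside; ⊥; ⁅_⁆; _∪_; _∈_; _∉_)
open import Data.Fin.Subset.Properties using (x∈⁅x⁆; x∈p∪q⁺; ∪-identityˡ)
import Data.Integer.Base as ℤ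
import Data.Integer.Properties as ℤ
open import Data.List.Base as List using (List; []; _∷_; filter; length; cartesianProductWith)
import Data.List.Properties as List
import Data.List.Relation.Unary.All as ListAll
open import Data.Maybe.Base using (Maybe; just; nothing; map; _<∣>_)
open import Data.Maybe using (Is-just)
import Data.Maybe.Relation.Unary.Any as Maybe
open import Data.Nat.Base using (zero; suc; _+_; _*_; _^_; _∸_; pred)
import Data.Nat.Properties as ℕ
open import Data.Product.Base using (_,_; ∃)
import Data.Rational.Base as ℚ
import Data.Rational.Properties as ℚ
import Data.Rational.Unnormalised.Base as ℚᵘ
import Data.Rational.Unnormalised.Properties as ℚᵘ
open import Data.Sum.Base using (_⊎_; inj₁; inj₂)
open import Data.Unit.Base using (tt)
open import Data.Vec.Base using (Vec; []; _∷_; _∷ʳ_; lookup; here; there)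
import Data.Vec.Properties as Vec
open import Data.Vec.Relation.Unary.All as All using (All; _∷_)
open import Function.Base using (_∘_)
open import Level using (0ℓ)
open import Relation.Binary.PropositionalEquality
  using (_≢_; refl; sym; trans; cong; cong₂; module ≡-Reasoning)
open import Relation.Nullary.Decidable using (Dec; does; yes; no; _×-dec_)
open import Relation.Nullary.Negation using (¬_; contradiction)
open import Relation.Unary using (Pred; Decidable; _≐_)

open import Algebra.Properties.CommutativeMonoid.Sum ℕ.+-0-commutativeMonoid
  using (sum-cong-≗; sum-replicate-zero; sum-init-last; sum-remove; ∑-comm; ∑-distrib-+)

private
  variable
    A : Set
    m n k : ℕ

open ≡-Reasoning

-- Sums over Fin n

∑-const : ∀ n c → ∑ℕ (λ (_ : Fin n) → c) ≡ n * c
∑-const zero    c = refl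
∑-const (suc n) c = cong (_+_ c) (∑-const n c)

∑-zero : (f : Fin n → ℕ) → (∀ i → f i ≡ 0) → ∑ℕ f ≡ 0
∑-zero {n} f f≡0 = trans (sum-cong-≗ f≡0) (sum-replicate-zero n)

∑-single : (f : Fin n → ℕ) (i : Fin n) → (∀ j → j ≢ i → f j ≡ 0) → ∑ℕ f ≡ f i
∑-single {suc n} f i f≡0 = begin
  ∑ℕ f                                    ≡⟨ sum-remove {i = i} f ⟩
  f i + ∑ℕ (λ j → f (punchIn i j))  ≡⟨ cong (_+_ (f i)) (∑-zero _ λ j → f≡0 _ (Fin.punchInᵢ≢i i j)) ⟩
  f i + 0                                 ≡⟨ ℕ.+-identityʳ (f i) ⟩
  f i                                     ∎

-- Counting

indicator : {P : Set} → Dec P → ℕ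
indicator d = if does d then 1 else 0

∑-indicator : {P : Fin n → Set} {Q : Set} (P? : ∀ i → Dec (P i)) (Q? : Dec Q) →
  (∀ {i j} → P i → P j → i ≡ j) → (Q → ∃ P) → (∀ {i} → P i → Q) →
  indicator Q? ≡ ∑ℕ (indicator ∘ P?)
∑-indicator {P = P} P? (no ¬q) uniq Q⇒P P⇒Q = sym (∑-zero _ λ i → absent i (P? i))
  where
  absent : ∀ i (d : Dec (P i)) → indicator d ≡ 0
  absent i (yes p) = contradiction (P⇒Q p) ¬q
  absent i (no _)  = refl
∑-indicator {P = P} P? (yes q) uniq Q⇒P P⇒Q with Q⇒P q
... | i , p = sym (trans (∑-single _ i λ j → absent j (P? j)) (present (P? i)))
  where
  absent : ∀ j (d : Dec (P j)) → j ≢ i → indicator d ≡ 0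
  absent j (yes p′) j≢i = contradiction (uniq p′ p) j≢i
  absent j (no _)   _   = refl
  present : (d : Dec (P i)) → indicator d ≡ 1
  present (yes _) = refl
  present (no ¬p) = contradiction p ¬p

length-filter-∷ : {P : Pred A 0ℓ} (P? : Decidable P) (x : A) (xs : List A) →
  length (filter P? (x ∷ xs)) ≡ indicator (P? x) + length (filter P? xs)
length-filter-∷ P? x xs with P? x
... | yes _ = refl
... | no  _ = refl

-- The sets `P i` are disjoint with union `Q`, so an element satisfying `Q` contributes to exactly
-- one summand. This serves to split a count of lucky spots by the car parked there.
length-filter-∑ : {P : Fin n → Pred A 0ℓ} {Q : Pred A 0ℓ}
  (P? : ∀ i → Decidable (P i)) (Q? : Decidable Q) →
  (∀ {x i j} → P i x → P j x → i ≡ j) →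
  (∀ {x} → Q x → ∃ λ i → P i x) → (∀ {x i} → P i x → Q x) →
  ∀ xs → length (filter Q? xs) ≡ ∑ℕ (λ i → length (filter (P? i) xs))
length-filter-∑ {n = n} P? Q? uniq Q⇒P P⇒Q [] = sym (sum-replicate-zero n)
length-filter-∑ P? Q? uniq Q⇒P P⇒Q (x ∷ xs) = begin
  length (filter Q? (x ∷ xs))
    ≡⟨ length-filter-∷ Q? x xs ⟩
  indicator (Q? x) + length (filter Q? xs)
    ≡⟨ cong₂ _+_ (∑-indicator (λ i → P? i x) (Q? x) uniq Q⇒P P⇒Q)
                 (length-filter-∑ P? Q? uniq Q⇒P P⇒Q xs) ⟩
  ∑ℕ (λ i → indicator (P? i x)) + ∑ℕ (λ i → length (filter (P? i) xs))
    ≡⟨ sym (∑-distrib-+ (λ i → indicator (P? i x)) (λ i → length (filter (P? i) xs))) ⟩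
  ∑ℕ (λ i → indicator (P? i x) + length (filter (P? i) xs))
    ≡⟨ sum-cong-≗ (λ i → sym (length-filter-∷ (P? i) x xs)) ⟩
  ∑ℕ (λ i → length (filter (P? i) (x ∷ xs))) ∎

length-filter-map : {B : Set} {P : Pred B 0ℓ} (P? : Decidable P) (f : A → B) (xs : List A) →
  length (filter P? (List.map f xs)) ≡ length (filter (P? ∘ f) xs)
length-filter-map P? f [] = refl
length-filter-map P? f (x ∷ xs) = begin
  length (filter P? (f x ∷ List.map f xs))
    ≡⟨ length-filter-∷ P? (f x) (List.map f xs) ⟩
  indicator (P? (f x)) + length (filter P? (List.map f xs))
    ≡⟨ cong (_+_ (indicator (P? (f x)))) (length-filter-map P? f xs) ⟩
  indicator (P? (f x)) + length (filter (P? ∘ f) xs)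
    ≡⟨ sym (length-filter-∷ (P? ∘ f) x xs) ⟩
  length (filter (P? ∘ f) (x ∷ xs)) ∎

-- `allFin n` is `tabulate` of the identity; an arbitrary `g` is allowed because the recursive call
-- tabulates `g ∘ suc`.
length-filter-cartesianProductWith : {B C : Set} {P : Pred C 0ℓ} (P? : Decidable P)
  (f : A → B → C) (g : Fin n → A) (ys : List B) →
  length (filter P? (cartesianProductWith f (List.tabulate g) ys))
    ≡ ∑ℕ (λ i → length (filter (P? ∘ f (g i)) ys))
length-filter-cartesianProductWith {n = zero}  P? f g ys = refl
length-filter-cartesianProductWith {n = suc n} P? f g ys = begin
  length (filter P? (List.map (f (g zero)) ys List.++ rest))
    ≡⟨ cong length (List.filter-++ P? (List.map (f (g zero)) ys) rest) ⟩
  length (filter P? (List.map (f (g zero)) ys) List.++ filter P? rest)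
    ≡⟨ List.length-++ (filter P? (List.map (f (g zero)) ys)) ⟩
  length (filter P? (List.map (f (g zero)) ys)) + length (filter P? rest)
    ≡⟨ cong₂ _+_ (length-filter-map P? (f (g zero)) ys)
                 (length-filter-cartesianProductWith P? f (g ∘ suc) ys) ⟩
  ∑ℕ (λ i → length (filter (P? ∘ f (g i)) ys)) ∎
  where rest = cartesianProductWith f (List.tabulate (g ∘ suc)) ys

-- Unlike in `count`, the number of cars `m` may differ from the number of spots `n`, as inductions
-- on the list of cars require.
# : {P : Pred (Vec (Fin n) m) 0ℓ} → Decidable P → ℕ
# {n} {m} P? = length (filter P? (allVecs n m))

#-∷ : {P : Pred (Vec (Fin n) (suc m)) 0ℓ} (P? : Decidable P) →
  # P? ≡ ∑ℕ (λ p → # (λ a → P? (p ∷ a)))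
#-∷ {n} {m} P? = length-filter-cartesianProductWith P? _∷_ (λ i → i) (allVecs n m)

#-cong : {P Q : Pred (Vec (Fin n) m) 0ℓ} (P? : Decidable P) (Q? : Decidable Q) →
  P ≐ Q → # P? ≡ # Q?
#-cong {n} {m} P? Q? P≐Q = cong length (List.filter-≐ P? Q? P≐Q (allVecs n m))

#-none : {P : Pred (Vec (Fin n) m) 0ℓ} (P? : Decidable P) → (∀ a → ¬ P a) → # P? ≡ 0
#-none {n} {m} P? ¬P = cong length (List.filter-none P? (ListAll.universal ¬P (allVecs n m)))

-- Parking

x∈⁅x⁆∪s : (x : Fin n) (s : Subset n) → x ∈ ⁅ x ⁆ ∪ s
x∈⁅x⁆∪s x s = x∈p∪q⁺ (inj₁ (x∈⁅x⁆ x))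

s⊆occupy : (s : Subset n) (mq : Maybe (Fin n)) {x : Fin n} → x ∈ s → x ∈ occupy s mq
s⊆occupy s (just q) x∈s = x∈p∪q⁺ {p = ⁅ q ⁆} (inj₂ x∈s)
s⊆occupy s nothing  x∈s = x∈s

firstFree-∉ : (s : Subset n) {q : Fin n} → firstFree s ≡ just q → q ∉ s
firstFree-∉ (outside ∷ s) refl ()
firstFree-∉ (inside ∷ s) eq q∈ with firstFree s in eq′
firstFree-∉ (inside ∷ s) refl (there q∈) | just q = firstFree-∉ s eq′ q∈

firstFreeFrom-∉ : (s : Subset n) (p : Fin n) {q : Fin n} → firstFreeFrom s p ≡ just q → q ∉ s
firstFreeFrom-∉ s       zero    eq q∈ = firstFree-∉ s eq q∈
firstFreeFrom-∉ (x ∷ s) (suc p) eq q∈ with firstFreeFrom s p in eq′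
firstFreeFrom-∉ (x ∷ s) (suc p) refl (there q∈) | just q = firstFreeFrom-∉ s p eq′ q∈

-- Cars never leave, so a spot that is free when car `i` arrives was already free at the start.
parked-∉ : (s : Subset n) (a : Vec (Fin n) k) (i : Fin k) {q : Fin n} →
  lookup (park s a) i ≡ just q → q ∉ s
parked-∉ s (p ∷ a) zero    eq q∈ = firstFreeFrom-∉ s p eq q∈
parked-∉ s (p ∷ a) (suc i) eq q∈ =
  parked-∉ _ a i eq (s⊆occupy s (firstFreeFrom s p) q∈)

-- The earlier of two cars would occupy `q`, and by `parked-∉` the later one could not park there.
parked-injective : (s : Subset n) (a : Vec (Fin n) k) {i j : Fin k} {q : Fin n} →
  lookup (park s a) i ≡ just q → lookup (park s a) j ≡ just q → i ≡ j
parked-injective s (p ∷ a) {zero}  {zero}  _   _   = refl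
parked-injective s (p ∷ a) {zero}  {suc j} {q} eqᵢ eqⱼ rewrite eqᵢ =
  contradiction (x∈⁅x⁆∪s q s) (parked-∉ _ a j eqⱼ)
parked-injective s (p ∷ a) {suc i} {zero}  {q} eqᵢ eqⱼ rewrite eqⱼ =
  contradiction (x∈⁅x⁆∪s q s) (parked-∉ _ a i eqᵢ)
parked-injective s (p ∷ a) {suc i} {suc j} eqᵢ eqⱼ =
  cong suc (parked-injective _ a eqᵢ eqⱼ)

firstFreeFrom-last : (s : Subset (suc m)) {q : Fin (suc m)} →
  firstFreeFrom s (fromℕ m) ≡ just q → q ≡ fromℕ m
firstFreeFrom-last {zero}  s {zero} _ = refl
firstFreeFrom-last {suc m} (x ∷ s) eq with firstFreeFrom s (fromℕ m) in eq′
firstFreeFrom-last {suc m} (x ∷ s) refl | just q = cong suc (firstFreeFrom-last s eq′)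

-- There is no spot beyond the last one, so a car that prefers it either parks there or fails.
prefers-last⇒lucky : (s : Subset (suc m)) (a : Vec (Fin (suc m)) k) (i : Fin k) →
  All Is-just (park s a) → lookup a i ≡ fromℕ m → lookup (park s a) i ≡ just (fromℕ m)
prefers-last⇒lucky {m} s (p ∷ a) zero (just-q ∷ _) refl
  with firstFreeFrom s (fromℕ m) in eq
... | just q  = cong just (firstFreeFrom-last s eq)
... | nothing with () ← just-q
prefers-last⇒lucky s (p ∷ a) (suc i) (_ ∷ parks) eq = prefers-last⇒lucky _ a i parks eq

-- Splitting off the last spot

lookup-∷ʳ-fromℕ : (s : Subset m) (x : Side) → lookup (s ∷ʳ x) (fromℕ m) ≡ x
lookup-∷ʳ-fromℕ []      x = refl
lookup-∷ʳ-fromℕ (_ ∷ s) x = lookup-∷ʳ-fromℕ s x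

lookup-∷ʳ-inject₁ : (s : Subset m) (x : Side) (i : Fin m) → lookup (s ∷ʳ x) (inject₁ i) ≡ lookup s i
lookup-∷ʳ-inject₁ (_ ∷ s) x zero    = refl
lookup-∷ʳ-inject₁ (_ ∷ s) x (suc i) = lookup-∷ʳ-inject₁ s x i

⊥-∷ʳ : ∀ m → ⊥ {m} ∷ʳ outside ≡ ⊥
⊥-∷ʳ zero    = refl
⊥-∷ʳ (suc m) = cong (outside ∷_) (⊥-∷ʳ m)

⁅fromℕ⁆∪∷ʳ : (s : Subset m) (x : Side) → ⁅ fromℕ m ⁆ ∪ (s ∷ʳ x) ≡ s ∷ʳ inside
⁅fromℕ⁆∪∷ʳ []      x = refl
⁅fromℕ⁆∪∷ʳ (y ∷ s) x = cong (y ∷_) (⁅fromℕ⁆∪∷ʳ s x)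

⁅inject₁⁆∪∷ʳ : (q : Fin m) (s : Subset m) (x : Side) →
  ⁅ inject₁ q ⁆ ∪ (s ∷ʳ x) ≡ (⁅ q ⁆ ∪ s) ∷ʳ x
⁅inject₁⁆∪∷ʳ zero    (y ∷ s) x = cong (inside ∷_)
  (trans (∪-identityˡ (s ∷ʳ x)) (cong (_∷ʳ x) (sym (∪-identityˡ s))))
⁅inject₁⁆∪∷ʳ (suc q) (y ∷ s) x = cong (y ∷_) (⁅inject₁⁆∪∷ʳ q s x)

-- The result for a car that has found no spot before the last one.
lastIfFree : Side → Maybe (Fin (suc m))
lastIfFree inside  = nothing
lastIfFree outside = just (fromℕ _)

map-suc-lastIfFree : (x : Side) → map suc (lastIfFree {m} x) ≡ lastIfFree x
map-suc-lastIfFree inside  = refl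
map-suc-lastIfFree outside = refl

firstFree-∷ʳ : (s : Subset m) (x : Side) →
  firstFree (s ∷ʳ x) ≡ map inject₁ (firstFree s) <∣> lastIfFree x
firstFree-∷ʳ []            inside  = refl
firstFree-∷ʳ []            outside = refl
firstFree-∷ʳ (outside ∷ s) x       = refl
firstFree-∷ʳ (inside ∷ s)  x rewrite firstFree-∷ʳ s x with firstFree s
... | just q  = refl
... | nothing = map-suc-lastIfFree x

firstFreeFrom-∷ʳ-inject₁ : (s : Subset m) (x : Side) (p : Fin m) →
  firstFreeFrom (s ∷ʳ x) (inject₁ p) ≡ map inject₁ (firstFreeFrom s p) <∣> lastIfFree x
firstFreeFrom-∷ʳ-inject₁ (y ∷ s) x zero = firstFree-∷ʳ (y ∷ s) x
firstFreeFrom-∷ʳ-inject₁ (y ∷ s) x (suc p)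
  rewrite firstFreeFrom-∷ʳ-inject₁ s x p with firstFreeFrom s p
... | just q  = refl
... | nothing = map-suc-lastIfFree x

firstFreeFrom-∷ʳ-fromℕ : (s : Subset m) (x : Side) →
  firstFreeFrom (s ∷ʳ x) (fromℕ m) ≡ lastIfFree x
firstFreeFrom-∷ʳ-fromℕ []      inside  = refl
firstFreeFrom-∷ʳ-fromℕ []      outside = refl
firstFreeFrom-∷ʳ-fromℕ (y ∷ s) x =
  trans (cong (map suc) (firstFreeFrom-∷ʳ-fromℕ s x)) (map-suc-lastIfFree x)

-- The state `x` of the last spot does not affect whether a car stops earlier. Each alternative
-- holds for all `x` at once, so that the street with its last spot occupied can be compared with
-- the circle on which it is vacant.
parksBeforeLast? : (s : Subset m) (p : Fin (suc m)) →
  (∃ λ q → ∀ x → firstFreeFrom (s ∷ʳ x) p ≡ just (inject₁ q)) ⊎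
  (∀ x → firstFreeFrom (s ∷ʳ x) p ≡ lastIfFree x)
parksBeforeLast? s p with view p
... | ‵fromℕ     = inj₂ (firstFreeFrom-∷ʳ-fromℕ s)
... | ‵inject₁ p with firstFreeFrom s p in eq
...   | just q  = inj₁ (q , λ x → trans (firstFreeFrom-∷ʳ-inject₁ s x p)
                                        (cong (λ mq → map inject₁ mq <∣> lastIfFree x) eq))
...   | nothing = inj₂ (λ x → trans (firstFreeFrom-∷ʳ-inject₁ s x p)
                                    (cong (λ mq → map inject₁ mq <∣> lastIfFree x) eq))

-- Parking on a circle

-- The second search restarts at the first spot. It is reached only when every spot from `p` on is
-- occupied, so it yields the next vacant spot around the circle.
firstFreeCyclic : Subset n → Fin n → Maybe (Fin n)
firstFreeCyclic s p = firstFreeFrom s p <∣> firstFree s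

-- The number of preference lists of k cars which leave spot e vacant when the
-- cars park on a circle with the spots in s already occupied.
sparing : ℕ → Fin n → Subset n → ℕ
sparing zero    e s = if lookup s e then 0 else 1
sparing (suc k) e s = ∑ℕ (λ p → sparing k e (occupy s (firstFreeCyclic s p)))

sparing-occupied : ∀ k {e : Fin n} {s : Subset n} → e ∈ s → sparing k e s ≡ 0
sparing-occupied zero    e∈s rewrite Vec.[]=⇒lookup e∈s = refl
sparing-occupied (suc k) {s = s} e∈s =
  ∑-zero _ λ p → sparing-occupied k (s⊆occupy s (firstFreeCyclic s p) e∈s)

-- Total number of vacant spots

vacancies : Subset n → ℕ
vacancies s = ∑ℕ (λ e → sparing 0 e s)

vacancies-∪ : (q : Fin n) (s : Subset n) → q ∉ s → vacancies (⁅ q ⁆ ∪ s) ≡ pred (vacancies s)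
vacancies-∪ zero    (inside ∷ s)  q∉s = contradiction here q∉s
vacancies-∪ zero    (outside ∷ s) q∉s = cong vacancies (∪-identityˡ s)
vacancies-∪ (suc q) (inside ∷ s)  q∉s = vacancies-∪ q s (q∉s ∘ there)
vacancies-∪ (suc q) (outside ∷ s) q∉s = trans
  (cong suc (vacancies-∪ q s (q∉s ∘ there)))
  -- The tail has the vacant spot `q`, so its `pred` is not truncated.
  (ℕ.suc-pred (vacancies s) {{positive q s (q∉s ∘ there)}})
  where
  positive : ∀ {n} (q : Fin n) (s : Subset n) → q ∉ s → NonZero (vacancies s)
  positive zero    (inside ∷ s)  q∉s = contradiction here q∉s
  positive (suc q) (inside ∷ s)  q∉s = positive q s (q∉s ∘ there)
  positive q       (outside ∷ s) q∉s = _

firstFree-full : (s : Subset n) → firstFree s ≡ nothing → vacancies s ≡ 0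
firstFree-full []           eq = refl
firstFree-full (inside ∷ s) eq with firstFree s in eq′
... | nothing = firstFree-full s eq′

-- On a circle every car parks as long as some spot is vacant. If none is, both sides are `0`,
-- because `pred 0` is `0`.
vacancies-occupy : (s : Subset n) (p : Fin n) →
  vacancies (occupy s (firstFreeCyclic s p)) ≡ pred (vacancies s)
vacancies-occupy s p with firstFreeFrom s p in eq
... | just q = vacancies-∪ q s (firstFreeFrom-∉ s p eq)
... | nothing with firstFree s in eq′
...   | just q  = vacancies-∪ q s (firstFree-∉ s eq′)
...   | nothing rewrite firstFree-full s eq′ = refl

-- Double counting: after exchanging the two sums, each of the `n` preferences of the first car
-- leaves one vacancy fewer, whichever spot it takes. Truncated subtraction covers the case of more
-- cars than vacancies.
∑-sparing : ∀ k (s : Subset n) → ∑ℕ (λ e → sparing k e s) ≡ n ^ k * (vacancies s ∸ k)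
∑-sparing zero        s = sym (ℕ.*-identityˡ _)
∑-sparing {n} (suc k) s = begin
  ∑ℕ (λ e → ∑ℕ (λ p → sparing k e (next p)))       ≡⟨ ∑-comm (λ e p → sparing k e (next p)) ⟩
  ∑ℕ (λ p → ∑ℕ (λ e → sparing k e (next p)))       ≡⟨ sum-cong-≗ (λ p → ∑-sparing k (next p)) ⟩
  ∑ℕ (λ p → n ^ k * (vacancies (next p) ∸ k))       ≡⟨ sum-cong-≗ (λ p →
                                                         cong (λ v → n ^ k * (v ∸ k)) (vacancies-occupy s p)) ⟩
  ∑ℕ (λ (_ : Fin n) → n ^ k * (pred (vacancies s) ∸ k))     ≡⟨ ∑-const n _ ⟩
  n * (n ^ k * (pred (vacancies s) ∸ k))            ≡⟨ sym (ℕ.*-assoc n (n ^ k) _) ⟩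
  n ^ suc k * (pred (vacancies s) ∸ k)              ≡⟨ cong (n ^ suc k *_) (pred-∸ (vacancies s)) ⟩
  n ^ suc k * (vacancies s ∸ suc k)                 ∎
  where
  next : Fin n → Subset n
  next p = occupy s (firstFreeCyclic s p)
  pred-∸ : ∀ v → pred v ∸ k ≡ v ∸ suc k
  pred-∸ zero    = ℕ.0∸n≡0 k
  pred-∸ (suc v) = refl

-- Rotation

rotate : Subset (suc m) → Subset (suc m)
rotate (x ∷ s) = s ∷ʳ x

-- The new position of a spot after `rotate` has moved the first spot to the end.
cyclicPred : Fin (suc m) → Fin (suc m)
cyclicPred zero    = fromℕ _
cyclicPred (suc i) = inject₁ i

lookup-rotate : (s : Subset (suc m)) (e : Fin (suc m)) →
  lookup (rotate s) (cyclicPred e) ≡ lookup s e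
lookup-rotate (x ∷ s) zero    = lookup-∷ʳ-fromℕ s x
lookup-rotate (x ∷ s) (suc e) = lookup-∷ʳ-inject₁ s x e

-- Rotation only changes where the circle is cut: a search may wrap around on one side and run
-- straight on the other, but it meets the spots in the same cyclic order.
firstFreeCyclic-rotate : (s : Subset (suc m)) (p : Fin (suc m)) →
  firstFreeCyclic (rotate s) (cyclicPred p) ≡ map cyclicPred (firstFreeCyclic s p)
firstFreeCyclic-rotate (outside ∷ s) zero
  rewrite firstFreeFrom-∷ʳ-fromℕ s outside = refl
firstFreeCyclic-rotate (inside ∷ s) zero
  rewrite firstFreeFrom-∷ʳ-fromℕ s inside | firstFree-∷ʳ s inside with firstFree s
... | just _  = refl
... | nothing = refl
-- A car that finds `s` full from `p` on reaches the vacant spot `zero` by wrapping around, and the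
-- rotated copy of that spot directly.
firstFreeCyclic-rotate (outside ∷ s) (suc p)
  rewrite firstFreeFrom-∷ʳ-inject₁ s outside p with firstFreeFrom s p
... | just _  = refl
... | nothing = refl
firstFreeCyclic-rotate (inside ∷ s) (suc p)
  rewrite firstFreeFrom-∷ʳ-inject₁ s inside p | firstFree-∷ʳ s inside
  with firstFreeFrom s p | firstFree s
... | just _  | _       = refl
... | nothing | just _  = refl
... | nothing | nothing = refl

occupy-rotate : (s : Subset (suc m)) (mq : Maybe (Fin (suc m))) →
  occupy (rotate s) (map cyclicPred mq) ≡ rotate (occupy s mq)
occupy-rotate (x ∷ s) nothing        = refl
occupy-rotate (x ∷ s) (just zero)    =
  trans (⁅fromℕ⁆∪∷ʳ s x) (cong (_∷ʳ inside) (sym (∪-identityˡ s)))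
occupy-rotate (x ∷ s) (just (suc q)) = ⁅inject₁⁆∪∷ʳ q s x

∑-cyclicPred : (f : Fin (suc m) → ℕ) → ∑ℕ (f ∘ cyclicPred) ≡ ∑ℕ f
∑-cyclicPred {m} f = begin
  f (fromℕ m) + ∑ℕ (f ∘ inject₁) ≡⟨ ℕ.+-comm (f (fromℕ m)) _ ⟩
  ∑ℕ (f ∘ inject₁) + f (fromℕ m) ≡⟨ sym (sum-init-last f) ⟩
  ∑ℕ f                           ∎

sparing-rotate : ∀ k (e : Fin (suc m)) (s : Subset (suc m)) →
  sparing k (cyclicPred e) (rotate s) ≡ sparing k e s
sparing-rotate zero    e s = cong (if_then 0 else 1) (lookup-rotate s e)
sparing-rotate (suc k) e s = begin
  ∑ℕ (λ p → sparing k (cyclicPred e) (occupy (rotate s) (firstFreeCyclic (rotate s) p)))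
    -- Since `cyclicPred` permutes the spots, the preference of the first car may be relabelled
    -- along with the circle.
    ≡⟨ sym (∑-cyclicPred (λ p →
         sparing k (cyclicPred e) (occupy (rotate s) (firstFreeCyclic (rotate s) p)))) ⟩
  ∑ℕ (λ p → sparing k (cyclicPred e) (occupy (rotate s) (firstFreeCyclic (rotate s) (cyclicPred p))))
    ≡⟨ sum-cong-≗ (λ p → trans
         (cong (sparing k (cyclicPred e)) (trans
           (cong (occupy (rotate s)) (firstFreeCyclic-rotate s p))
           (occupy-rotate s (firstFreeCyclic s p))))
         (sparing-rotate k e (occupy s (firstFreeCyclic s p)))) ⟩
  ∑ℕ (λ p → sparing k e (occupy s (firstFreeCyclic s p))) ∎

-- The empty circle is fixed by `rotate`, so `e` and `cyclicPred e` are spared equally often. The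
-- induction starts from the last spot, which is `cyclicPred zero`.
sparing-⊥ : ∀ k (e : Fin (suc m)) → sparing k e ⊥ ≡ sparing k (fromℕ m) ⊥
sparing-⊥ {m} k = <-weakInduction (λ e → sparing k e ⊥ ≡ sparing k (fromℕ m) ⊥)
  (sym (invariant zero)) (λ i eq → trans (sym (invariant (suc i))) eq)
  where
  invariant : ∀ e → sparing k (cyclicPred e) ⊥ ≡ sparing k e ⊥
  invariant e = trans (cong (sparing k (cyclicPred e)) (sym (⊥-∷ʳ m))) (sparing-rotate k e ⊥)

vacancies-⊥ : ∀ n → vacancies (⊥ {n}) ≡ n
vacancies-⊥ zero    = refl
vacancies-⊥ (suc n) = cong suc (vacancies-⊥ n)

-- With `m` cars on `suc m` spots exactly one spot stays vacant, and by symmetry each spot has an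
-- equal share of the `suc m ^ m` lists.
*-sparing-⊥ : ∀ m → suc m * sparing m (fromℕ m) ⊥ ≡ suc m ^ m
*-sparing-⊥ m = begin
  suc m * sparing m (fromℕ m) ⊥                     ≡⟨ sym (∑-const (suc m) _) ⟩
  ∑ℕ (λ (_ : Fin (suc m)) → sparing m (fromℕ m) ⊥) ≡⟨ sum-cong-≗ (λ e → sym (sparing-⊥ m e)) ⟩
  ∑ℕ (λ e → sparing m e ⊥)                          ≡⟨ ∑-sparing m ⊥ ⟩
  suc m ^ m * (vacancies (⊥ {suc m}) ∸ m)           ≡⟨ cong (λ v → suc m ^ m * (v ∸ m)) (vacancies-⊥ (suc m)) ⟩
  suc m ^ m * (suc m ∸ m)                           ≡⟨ cong (suc m ^ m *_) (ℕ.m+n∸n≡m 1 m) ⟩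
  suc m ^ m * 1                                     ≡⟨ ℕ.*-identityʳ _ ⟩
  suc m ^ m                                         ∎

-- Cars preferring the last spot

AllPark : Subset n → Pred (Vec (Fin n) k) 0ℓ
AllPark s a = All Is-just (park s a)

allPark? : ∀ k (s : Subset n) → Decidable (AllPark {k = k} s)
allPark? k s a = All.all? (Maybe.dec (λ _ → yes tt)) (park s a)

allPark-∷⁻ : {s t : Subset n} (p : Fin n) {q : Fin n} (a : Vec (Fin n) k) →
  firstFreeFrom s p ≡ just q → ⁅ q ⁆ ∪ s ≡ t → AllPark s (p ∷ a) → AllPark t a
allPark-∷⁻ p a eq refl parks rewrite eq = All.tail parks

allPark-∷⁺ : {s t : Subset n} (p : Fin n) {q : Fin n} (a : Vec (Fin n) k) →
  firstFreeFrom s p ≡ just q → ⁅ q ⁆ ∪ s ≡ t → AllPark t a → AllPark s (p ∷ a)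
allPark-∷⁺ p a eq refl parks rewrite eq = Maybe.just tt ∷ parks

¬allPark-∷ : {s : Subset n} (p : Fin n) (a : Vec (Fin n) k) →
  firstFreeFrom s p ≡ nothing → ¬ AllPark s (p ∷ a)
¬allPark-∷ p a eq parks rewrite eq with () ← All.head parks

fromℕ∈∷ʳ : (s : Subset m) → fromℕ m ∈ s ∷ʳ inside
fromℕ∈∷ʳ s = Vec.lookup⇒[]= _ (s ∷ʳ inside) (lookup-∷ʳ-fromℕ s inside)

sparing-before : ∀ k (s : Subset m) (p : Fin (suc m)) {q : Fin m} →
  firstFreeFrom (s ∷ʳ outside) p ≡ just (inject₁ q) →
  sparing k (fromℕ m) (occupy (s ∷ʳ outside) (firstFreeCyclic (s ∷ʳ outside) p))
    ≡ sparing k (fromℕ m) ((⁅ q ⁆ ∪ s) ∷ʳ outside)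
sparing-before {m} k s p {q} eq rewrite eq =
  cong (sparing k (fromℕ m)) (⁅inject₁⁆∪∷ʳ q s outside)

sparing-last : ∀ k (s : Subset m) (p : Fin (suc m)) →
  firstFreeFrom (s ∷ʳ outside) p ≡ just (fromℕ m) →
  sparing k (fromℕ m) (occupy (s ∷ʳ outside) (firstFreeCyclic (s ∷ʳ outside) p)) ≡ 0
sparing-last {m} k s p eq rewrite eq =
  sparing-occupied k (x∈⁅x⁆∪s (fromℕ m) (s ∷ʳ outside))

-- Street and circle agree while cars stop before the last spot. The first car to get that far fails
-- on the street, where the spot is taken, and fills it on the circle; either way the list is ruled
-- out. In the surviving lists no car wraps around.
#-allPark : ∀ k (s : Subset m) →
  # (allPark? k (s ∷ʳ inside)) ≡ sparing k (fromℕ m) (s ∷ʳ outside)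
#-allPark     zero    s rewrite lookup-∷ʳ-fromℕ s outside = refl
#-allPark {m} (suc k) s = trans (#-∷ (allPark? (suc k) (s ∷ʳ inside))) (sum-cong-≗ step)
  where
  step : ∀ p → # (λ a → allPark? (suc k) (s ∷ʳ inside) (p ∷ a)) ≡
    sparing k (fromℕ m) (occupy (s ∷ʳ outside) (firstFreeCyclic (s ∷ʳ outside) p))
  step p with parksBeforeLast? s p
  ... | inj₁ (q , eq) = begin
    # (λ a → allPark? (suc k) (s ∷ʳ inside) (p ∷ a))
      ≡⟨ #-cong (λ a → allPark? (suc k) (s ∷ʳ inside) (p ∷ a)) (allPark? k ((⁅ q ⁆ ∪ s) ∷ʳ inside))
           ( (λ {a} → allPark-∷⁻ p a (eq inside) (⁅inject₁⁆∪∷ʳ q s inside))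
           , (λ {a} → allPark-∷⁺ p a (eq inside) (⁅inject₁⁆∪∷ʳ q s inside))) ⟩
    # (allPark? k ((⁅ q ⁆ ∪ s) ∷ʳ inside))
      ≡⟨ #-allPark k (⁅ q ⁆ ∪ s) ⟩
    sparing k (fromℕ m) ((⁅ q ⁆ ∪ s) ∷ʳ outside)
      ≡⟨ sym (sparing-before k s p (eq outside)) ⟩
    sparing k (fromℕ m) (occupy (s ∷ʳ outside) (firstFreeCyclic (s ∷ʳ outside) p)) ∎
  ... | inj₂ eq = trans
    (#-none (λ a → allPark? (suc k) (s ∷ʳ inside) (p ∷ a)) λ a → ¬allPark-∷ p a (eq inside))
    (sym (sparing-last k s p (eq outside)))

PrefersLast : Subset (suc m) → Fin k → Pred (Vec (Fin (suc m)) k) 0ℓ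
PrefersLast {m} s i a = AllPark s a × lookup a i ≡ fromℕ m

prefersLast? : ∀ k (s : Subset (suc m)) (i : Fin k) → Decidable (PrefersLast s i)
prefersLast? {m} k s i a = allPark? k s a ×-dec (lookup a i Fin.≟ fromℕ m)

-- Car `i` is deleted, leaving `k` cars on the circle. The cars before it must keep off the last
-- spot; once it has parked there, the later cars face a street whose last spot is taken, which is
-- the situation counted above.
#-prefersLast : ∀ k (i : Fin (suc k)) (s : Subset m) →
  # (prefersLast? (suc k) (s ∷ʳ outside) i) ≡ sparing k (fromℕ m) (s ∷ʳ outside)
#-prefersLast {m} k zero s = begin
  # (prefersLast? (suc k) (s ∷ʳ outside) zero)
    ≡⟨ #-∷ (prefersLast? (suc k) (s ∷ʳ outside) zero) ⟩
  ∑ℕ (λ p → # (startsWith? p))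
    ≡⟨ ∑-single (λ p → # (startsWith? p)) (fromℕ m)
         (λ p p≢last → #-none (startsWith? p) λ _ (_ , p≡last) → p≢last p≡last) ⟩
  # (startsWith? (fromℕ m))
    ≡⟨ #-cong (startsWith? (fromℕ m)) (allPark? k (s ∷ʳ inside))
         ( (λ {a} (parks , _) → allPark-∷⁻ (fromℕ m) a last-free (⁅fromℕ⁆∪∷ʳ s outside) parks)
         , (λ {a} parks → allPark-∷⁺ (fromℕ m) a last-free (⁅fromℕ⁆∪∷ʳ s outside) parks , refl)) ⟩
  # (allPark? k (s ∷ʳ inside))
    ≡⟨ #-allPark k s ⟩
  sparing k (fromℕ m) (s ∷ʳ outside) ∎
  where
  startsWith? : ∀ p → Decidable (λ a → PrefersLast (s ∷ʳ outside) zero (p ∷ a))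
  startsWith? p a = prefersLast? (suc k) (s ∷ʳ outside) zero (p ∷ a)
  last-free = firstFreeFrom-∷ʳ-fromℕ s outside
#-prefersLast {m} (suc k) (suc i) s =
  trans (#-∷ (prefersLast? (2 + k) (s ∷ʳ outside) (suc i))) (sum-cong-≗ step)
  where
  startsWith? : ∀ p → Decidable (λ a → PrefersLast (s ∷ʳ outside) (suc i) (p ∷ a))
  startsWith? p a = prefersLast? (2 + k) (s ∷ʳ outside) (suc i) (p ∷ a)
  step : ∀ p → # (startsWith? p) ≡
    sparing k (fromℕ m) (occupy (s ∷ʳ outside) (firstFreeCyclic (s ∷ʳ outside) p))
  step p with parksBeforeLast? s p
  ... | inj₁ (q , eq) = begin
    # (startsWith? p)
      ≡⟨ #-cong (startsWith? p) (prefersLast? (suc k) ((⁅ q ⁆ ∪ s) ∷ʳ outside) i)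
           ( (λ {a} (parks , last) → allPark-∷⁻ p a (eq outside) (⁅inject₁⁆∪∷ʳ q s outside) parks , last)
           , (λ {a} (parks , last) → allPark-∷⁺ p a (eq outside) (⁅inject₁⁆∪∷ʳ q s outside) parks , last)) ⟩
    # (prefersLast? (suc k) ((⁅ q ⁆ ∪ s) ∷ʳ outside) i)
      ≡⟨ #-prefersLast k i (⁅ q ⁆ ∪ s) ⟩
    sparing k (fromℕ m) ((⁅ q ⁆ ∪ s) ∷ʳ outside)
      ≡⟨ sym (sparing-before k s p (eq outside)) ⟩
    sparing k (fromℕ m) (occupy (s ∷ʳ outside) (firstFreeCyclic (s ∷ʳ outside) p)) ∎
  -- A car ahead of car `i` takes the last spot, so car `i`, which prefers it, could park only in an
  -- occupied spot. On the circle that spot is no longer spared.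
  ... | inj₂ eq = trans
    (#-none (startsWith? p) λ a (parks , last) →
      let parks′ = allPark-∷⁻ p a (eq outside) (⁅fromℕ⁆∪∷ʳ s outside) parks in
      parked-∉ (s ∷ʳ inside) a i (prefers-last⇒lucky (s ∷ʳ inside) a i parks′ last) (fromℕ∈∷ʳ s))
    (sym (sparing-last k s p (eq outside)))

-- Luckiness is automatic by `prefers-last⇒lucky`, so only parking and the preference need counting.
q-last : ∀ m (i : Fin (suc m)) → q (suc m) i (fromℕ m) ≡ sparing m (fromℕ m) ⊥
q-last m i = begin
  q (suc m) i (fromℕ m)
    ≡⟨ #-cong (λ a → isParkingFunction? a ×-dec (lookup a i Fin.≟ fromℕ m) ×-dec luckyCar? a i)
         (prefersLast? (suc m) ⊥ i)
         ( (λ {a} (parks , last , _) → parks , last)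
         , (λ {a} (parks , last) → parks , last ,
              trans (prefers-last⇒lucky ⊥ a i parks last) (cong just (sym last)))) ⟩
  # (prefersLast? (suc m) ⊥ i)
    ≡⟨ cong (λ s → # (prefersLast? (suc m) s i)) (sym (⊥-∷ʳ m)) ⟩
  # (prefersLast? (suc m) (⊥ ∷ʳ outside) i)
    ≡⟨ #-prefersLast m i ⊥ ⟩
  sparing m (fromℕ m) (⊥ ∷ʳ outside)
    ≡⟨ cong (sparing m (fromℕ m)) (⊥-∷ʳ m) ⟩
  sparing m (fromℕ m) ⊥ ∎

-- Summing over the `suc m` cars supplies the factor in `*-sparing-⊥`, so no division occurs.
∑-q-last : ∀ m → ∑ℕ (λ i → q (suc m) i (fromℕ m)) ≡ suc m ^ m
∑-q-last m = begin
  ∑ℕ (λ i → q (suc m) i (fromℕ m))                 ≡⟨ sum-cong-≗ (q-last m) ⟩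
  ∑ℕ (λ (_ : Fin (suc m)) → sparing m (fromℕ m) ⊥) ≡⟨ ∑-const (suc m) _ ⟩
  suc m * sparing m (fromℕ m) ⊥                    ≡⟨ *-sparing-⊥ m ⟩
  suc m ^ m                                        ∎

-- By `parked-injective` at most one car parks in spot `j`, so the lists in which `j` is lucky split
-- according to that car.
#luckySpot-∑-q : ∀ n (j : Fin n) → #luckySpot n j ≡ ∑ℕ (λ i → q n i j)
#luckySpot-∑-q n j = length-filter-∑
  (λ i a → isParkingFunction? a ×-dec (lookup a i Fin.≟ j) ×-dec luckyCar? a i)
  (λ a → isParkingFunction? a ×-dec luckySpot? a j)
  (λ {a} (_ , eqᵢ , luckyᵢ) (_ , eqⱼ , luckyⱼ) → parked-injective ⊥ a
    (trans luckyᵢ (cong just eqᵢ)) (trans luckyⱼ (cong just eqⱼ)))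
  (λ (parks , i , parksIn , eq) → i , parks , eq , trans parksIn (cong just (sym eq)))
  (λ (parks , eq , lucky) → parks , _ , trans lucky (cong just eq) , eq)
  (allVecs n n)

-- Powers in ℚ

-- Rationals are kept in lowest terms, so the identity is checked on unnormalised fractions with
-- denominator 1 and pulled back along `toℚᵘ`.
fromℕℚ-+ : ∀ a b → fromℕℚ (a + b) ≡ fromℕℚ a ℚ.+ fromℕℚ b
fromℕℚ-+ a b = ℚ.toℚᵘ-injective (begin′
  ℚ.toℚᵘ (fromℕℚ (a + b))                     ≈⟨ ℚ.toℚᵘ-fromℚᵘ (ℚᵘ.mkℚᵘ (+ (a + b)) 0) ⟩
  ℚᵘ.mkℚᵘ (+ (a + b)) 0                       ≈⟨ ℚᵘ.*≡* (cong (ℤ._* + 1) (sym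
                                                   (cong₂ ℤ._+_ (ℤ.*-identityʳ (+ a)) (ℤ.*-identityʳ (+ b))))) ⟩
  ℚᵘ.mkℚᵘ (+ a) 0 ℚᵘ.+ ℚᵘ.mkℚᵘ (+ b) 0         ≈⟨ ℚᵘ.≃-sym (ℚᵘ.+-cong
                                                   (ℚ.toℚᵘ-fromℚᵘ (ℚᵘ.mkℚᵘ (+ a) 0))
                                                   (ℚ.toℚᵘ-fromℚᵘ (ℚᵘ.mkℚᵘ (+ b) 0))) ⟩
  ℚ.toℚᵘ (fromℕℚ a) ℚᵘ.+ ℚ.toℚᵘ (fromℕℚ b)    ≈⟨ ℚᵘ.≃-sym (ℚ.toℚᵘ-homo-+ (fromℕℚ a) (fromℕℚ b)) ⟩
  ℚ.toℚᵘ (fromℕℚ a ℚ.+ fromℕℚ b) ∎′)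
  where open ℚᵘ.≃-Reasoning renaming (begin_ to begin′_; _∎ to _∎′)

∑ℚ-const : ∀ n c → ∑ℚ (λ (_ : Fin n) → fromℕℚ c) ≡ fromℕℚ (n * c)
∑ℚ-const zero    c = refl
∑ℚ-const (suc n) c = trans (cong (fromℕℚ c ℚ.+_) (∑ℚ-const n c)) (sym (fromℕℚ-+ c (n * c)))

∑ℚ-^ℤ : ∀ m → ∑ℚ (λ (_ : Fin (suc m)) → suc m ^ℤ (+ suc m - + 2)) ≡ fromℕℚ (suc m ^ m)
-- Here the exponent is -1, the only negative one, and both sides compute to 1.
∑ℚ-^ℤ zero    = refl
-- The exponent computes to `+ m`, and `(2 + m) * (2 + m) ^ m` is the next power by definition.
∑ℚ-^ℤ (suc m) = ∑ℚ-const (2 + m) ((2 + m) ^ m)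

mainTheorem10 : (n : ℕ) .{{_ : NonZero n}} →
    (#luckySpot n (lastSpot n) ≡ ∑ℕ (λ (i : Fin n) → q n i (lastSpot n))) ×
    (fromℕℚ (∑ℕ (λ (i : Fin n) → q n i (lastSpot n))) ≡ ∑ℚ (λ (i : Fin n) → n ^ℤ (+ n - + 2))) ×
    (∑ℚ (λ (i : Fin n) → n ^ℤ (+ n - + 2)) ≡ n ^ℤ (+ n - + 1))
mainTheorem10 (suc m) =
  #luckySpot-∑-q (suc m) (fromℕ m) ,
  trans (cong fromℕℚ (∑-q-last m)) (sym (∑ℚ-^ℤ m)) ,
  -- The exponent `+ suc m - + 1` computes to `+ m`.
  ∑ℚ-^ℤ m
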